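{- For every integer $n \geq 6$, the graph $G(n,n,n)$ has a nonorientable quadrangular embedding.
   Context: For nonnegative integers $m,n,k$ with $k \le \min(m,n)$, $G(m,n,k)$ denotes the nearly complete bipartite graph obtained from the complete bipartite graph $K_{m,n}$ (with $m$ white vertices and $n$ black vertices) by deleting $k$ pairwise independent edges (a matching of size $k$); thus $G(n,n,n)$ is $K_{n,n}$ minus a perfect matching. An embedding of a graph in a closed surface is cellular if every face is an open disk; a quadrangular embedding is a cellular embedding in which every face is bounded by a closed walk of length 4. A nonorientable quadrangular embedding is a quadrangular embedding in a nonorientable closed surface. -}

module Defs where

open import Data.Nat using (ℕ; zero; suc; _<_)
open import Data.Fin using (Fin; _≟_)
open import Data.Bool using (Bool; true; false; not)
open import Data.Product using (Σ; _×_; _,_)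
open import Data.Sum using (_⊎_)
open import Relation.Nullary using (¬_)
open import Relation.Nullary.Decidable using (False)
open import Relation.Binary.PropositionalEquality using (_≡_; _≢_)
open import Relation.Binary.Construct.Closure.ReflexiveTransitive using (Star)

-- Combinatorial (flag / "graph-encoded map") description of cellular embeddings
-- of the graph G(n,n,n) = K_{n,n} minus the perfect matching {w_i b_i}.
--
-- Vertices: (false , i) is the white vertex w_i, (true , j) the black vertex b_j.
Vertex : ℕ → Set
Vertex n = Bool × Fin n

-- A flag of the embedding: an edge w_i b_j (i ≠ j), an end of that edge
-- (atBlack = true means the end at b_j) and a side of that edge.
record Flag (n : ℕ) : Set where
  constructor flag
  field
    white   : Fin n
    black   : Fin n
    nonDiag : False (white ≟ black)   -- w_i b_i is a deleted edge
    atBlack : Bool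
    side    : Bool
open Flag public

vertexOf : ∀ {n} → Flag n → Vertex n
vertexOf (flag i j _ false _) = false , i
vertexOf (flag i j _ true  _) = true , j

τ₀ : ∀ {n} → Flag n → Flag n
τ₀ (flag i j p e s) = flag i j p (not e) s

τ₂ : ∀ {n} → Flag n → Flag n
τ₂ (flag i j p e s) = flag i j p e (not s)

iter : ∀ {A : Set} → (A → A) → ℕ → A → A
iter f zero    x = x
iter f (suc k) x = f (iter f k x)

data VStep {n : ℕ} (τ₁ : Flag n → Flag n) : Flag n → Flag n → Set where
  by-τ₁ : ∀ f → VStep τ₁ f (τ₁ f)
  by-τ₂ : ∀ f → VStep τ₁ f (τ₂ f)

-- A cellular embedding of G(n,n,n) in a closed surface, as a combinatorial map
-- whose flags are those of G(n,n,n): τ₀, τ₂ are fixed by the graph, τ₁ is a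
-- fixed-point-free involution preserving the vertex and acting (together with
-- τ₂) transitively on the flags at each vertex (so each vertex has a disk
-- neighbourhood).
record Embedding (n : ℕ) : Set where
  field
    τ₁         : Flag n → Flag n
    τ₁-invol   : ∀ f → τ₁ (τ₁ f) ≡ f
    τ₁-fpf     : ∀ f → τ₁ f ≢ f
    τ₁-vertex  : ∀ f → vertexOf (τ₁ f) ≡ vertexOf f
    vertex-transitive : ∀ f g → vertexOf f ≡ vertexOf g → Star (VStep τ₁) f g

  -- walking along a face boundary by one edge
  ρ : Flag n → Flag n
  ρ f = τ₀ (τ₁ f)
open Embedding public

Quadrangular : ∀ {n} → Embedding n → Set
Quadrangular E =
  ∀ f → iter (ρ E) 4 f ≡ f × (∀ k → 0 < k → k < 4 → iter (ρ E) k f ≢ f)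

Orientable : ∀ {n} → Embedding n → Set
Orientable {n} E =
  Σ (Flag n → Bool) λ c →
    ∀ f → c (τ₀ f) ≢ c f × c (τ₁ E f) ≢ c f × c (τ₂ f) ≢ c f

Nonorientable : ∀ {n} → Embedding n → Set
Nonorientable E = ¬ Orientable E

{-# OPTIONS --safe #-}

-- Let N = 2m + 1 and give the edge w_i b_{i+a} of G(N,N,N) the label a ∈ ℤ_N, a ≠ 0. A quadruple
-- (a , b , c , d) of labels with a + c = b + d stands for an orbit of N quadrilaterals, with corners
-- (a , b), (c , d) at white and (b , c), (d , a) at black vertices. Quadruples that use every label
-- twice give an embedding as soon as their white corners form a single cycle on the labels and
-- their black corners do too. A quadruple (a , b , - a , - b) is always admissible, so one may take
-- long chains (x , y , - x , - y), (y , z , - y , - z), …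
--
-- n = N odd, m ≥ 4:  (2 , 4 , 3 , 1), (-3 , -4 , -2 , -1), (2 , 3 , -2 , -3), the chain through
--                    4 , 5 , … , m, and (m , -1 , -m , 1).
-- n = N = 7:         (1 , 3 , 1 , -1), (2 , -2 , 2 , -1), (3 , -3 , -2 , -3).
-- n = N + 1, m ≥ 2:  the chain through 1 , 2 , … , m, together with vertices w_∞, b_∞ fixed by ℤ_N and
--                    the quadrilaterals w_∞ b_{i+1} w_i b_{i-1} and b_∞ w_{i-m} b_i w_{i+m}.
--
-- In each case some walk with an odd number of steps leads from a flag to a nontrivial translate of it,
-- so a 2-colouring witnessing orientability would be inverted by a translation of odd order N.
module Submission where

open import Defs
open import Data.Bool using (Bool; true; false; not; _xor_; if_then_else_)
import Data.Bool.Properties as Bool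
open import Data.Bool.Properties using (not-involutive; not-¬; ¬-not; T-irrelevant; xor-identityʳ)
open import Data.Empty using (⊥-elim)
open import Data.Fin using (Fin; zero; suc; toℕ; _↑ˡ_; _↑ʳ_; splitAt; join; opposite; inject₁; fromℕ; _≟_)
open import Data.Fin.Induction using (<-weakInduction)
open import Data.Fin.Patterns using (0F; 1F; 2F)
import Data.Fin.Properties as Fin
open import Data.Fin.Properties using (toℕ-injective; toℕ-fromℕ; toℕ-fromℕ<; toℕ<n; toℕ-↑ˡ; toℕ-↑ʳ; opposite-prop; opposite-involutive; splitAt-join; join-splitAt; suc-injective)
open import Data.Fin.Relation.Unary.Top using (View; view; ‵fromℕ; ‵inj₁; ‵inject₁; view-fromℕ; view-inject₁)
open import Data.List using (List; []; _∷_; foldr; length)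
open import Data.Nat using (ℕ; zero; suc; _+_; _∸_; _*_; _≤_; _<_; s≤s)
open import Data.Nat.DivMod using (_%_; _mod_; %-distribˡ-+; m<n⇒m%n≡m; [m+kn]%n≡m%n; n%n≡0; m*n%n≡0; m%n<n)
import Data.Nat.Properties as ℕ
open import Data.Nat.Tactic.RingSolver using (solve-∀)
open import Data.Product using (Σ; _×_; _,_; proj₁; proj₂)
open import Data.Product.Properties using (≡-dec)
open import Data.Sum using (_⊎_; inj₁; inj₂)
open import Function using (_∘_)
open import Relation.Binary.Construct.Closure.ReflexiveTransitive using (Star; ε; _◅_; _◅◅_; gmap; reverse)
open import Relation.Binary.PropositionalEquality
open import Relation.Nullary using (¬_; Dec; ¬?)
open import Relation.Nullary.Decidable using (False; fromWitnessFalse; toWitnessFalse; map′; _×-dec_; from-yes)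
open import Relation.Unary using (Decidable)

not≢ : ∀ {b} → not b ≢ b
not≢ {b} eq = not-¬ {b} refl (sym eq)

inject₁≢suc : ∀ {n} {k : Fin n} → inject₁ k ≢ suc k
inject₁≢suc {k = suc k} eq = inject₁≢suc (suc-injective eq)

-- Arithmetic in ℤ_N for N = 2m + 1, and labels for its nonzero elements.

module Cyclic (m : ℕ) where

  N : ℕ
  N = suc (m + m)

  infixl 6 _⊕_
  opaque
    -- Opaque, as is `val`, so that symbolic sums stay unevaluated; only the finite check for N = 7
    -- unfolds them.
    _⊕_ : Fin N → Fin N → Fin N
    i ⊕ j = (toℕ i + toℕ j) mod N

    ⊕-def : ∀ i j → i ⊕ j ≡ (toℕ i + toℕ j) mod N
    ⊕-def i j = refl

  toℕ-mod : ∀ a → toℕ (a mod N) ≡ a % N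
  toℕ-mod a = toℕ-fromℕ< (m%n<n a N)

  mod-toℕ : ∀ i → toℕ i mod N ≡ i
  mod-toℕ i = toℕ-injective (trans (toℕ-mod (toℕ i)) (m<n⇒m%n≡m (toℕ<n i)))

  mod-+ : ∀ a b → (a mod N) ⊕ (b mod N) ≡ (a + b) mod N
  mod-+ a b = toℕ-injective (begin
    toℕ ((a mod N) ⊕ (b mod N))              ≡⟨ cong toℕ (⊕-def (a mod N) (b mod N)) ⟩
    toℕ ((toℕ (a mod N) + toℕ (b mod N)) mod N)
                                             ≡⟨ toℕ-mod (toℕ (a mod N) + toℕ (b mod N)) ⟩
    (toℕ (a mod N) + toℕ (b mod N)) % N      ≡⟨ cong₂ (λ x y → (x + y) % N) (toℕ-mod a) (toℕ-mod b) ⟩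
    (a % N + b % N) % N                      ≡⟨ %-distribˡ-+ a b N ⟨
    (a + b) % N                              ≡⟨ toℕ-mod (a + b) ⟨
    toℕ ((a + b) mod N)                      ∎)
    where open ≡-Reasoning

  ⊕-comm : ∀ i j → i ⊕ j ≡ j ⊕ i
  ⊕-comm i j = trans (⊕-def i j) (trans (cong (_mod N) (ℕ.+-comm (toℕ i) (toℕ j))) (sym (⊕-def j i)))

  ⊕-assoc : ∀ i j k → (i ⊕ j) ⊕ k ≡ i ⊕ (j ⊕ k)
  ⊕-assoc i j k = begin
    (i ⊕ j) ⊕ k                              ≡⟨ cong₂ _⊕_ (sym (⊕-def i j)) (mod-toℕ k) ⟨
    ((toℕ i + toℕ j) mod N) ⊕ (toℕ k mod N)  ≡⟨ mod-+ (toℕ i + toℕ j) (toℕ k) ⟩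
    (toℕ i + toℕ j + toℕ k) mod N            ≡⟨ cong (_mod N) (ℕ.+-assoc (toℕ i) (toℕ j) (toℕ k)) ⟩
    (toℕ i + (toℕ j + toℕ k)) mod N          ≡⟨ mod-+ (toℕ i) (toℕ j + toℕ k) ⟨
    (toℕ i mod N) ⊕ ((toℕ j + toℕ k) mod N)  ≡⟨ cong₂ _⊕_ (mod-toℕ i) (sym (⊕-def j k)) ⟩
    i ⊕ (j ⊕ k)                              ∎
    where open ≡-Reasoning

  ⊕-identityʳ : ∀ i → i ⊕ zero ≡ i
  ⊕-identityʳ i = trans (⊕-def i zero) (trans (cong (_mod N) (ℕ.+-identityʳ (toℕ i))) (mod-toℕ i))

  N-mod : N mod N ≡ zero
  N-mod = toℕ-injective (trans (toℕ-mod N) (n%n≡0 N))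

  cancel : ∀ u {a b} → a ⊕ b ≡ zero → (u ⊕ a) ⊕ b ≡ u
  cancel u {a} {b} ab = trans (⊕-assoc u a b) (trans (cong (u ⊕_) ab) (⊕-identityʳ u))

  ⊕-swap : ∀ u a b → (u ⊕ a) ⊕ b ≡ (u ⊕ b) ⊕ a
  ⊕-swap u a b = trans (⊕-assoc u a b) (trans (cong (u ⊕_) (⊕-comm a b)) (sym (⊕-assoc u b a)))

  neg : Fin N → Fin N
  neg i = (N ∸ toℕ i) mod N

  neg-inverse : ∀ i → i ⊕ neg i ≡ zero
  neg-inverse i = begin
    i ⊕ neg i                        ≡⟨ cong (_⊕ neg i) (mod-toℕ i) ⟨
    (toℕ i mod N) ⊕ neg i            ≡⟨ mod-+ (toℕ i) (N ∸ toℕ i) ⟩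
    (toℕ i + (N ∸ toℕ i)) mod N      ≡⟨ cong (_mod N) (ℕ.m+[n∸m]≡n (ℕ.<⇒≤ (toℕ<n i))) ⟩
    N mod N                          ≡⟨ N-mod ⟩
    zero                             ∎
    where open ≡-Reasoning

  ⊕-cancelʳ : ∀ u {i j} → i ⊕ u ≡ j ⊕ u → i ≡ j
  ⊕-cancelʳ u {i} {j} eq = trans (sym (cancel i (neg-inverse u))) (trans (cong (_⊕ neg u) eq) (cancel j (neg-inverse u)))

  ⊕-cancelˡ : ∀ u {i j} → u ⊕ i ≡ u ⊕ j → i ≡ j
  ⊕-cancelˡ u {i} {j} eq = ⊕-cancelʳ u (trans (⊕-comm i u) (trans eq (⊕-comm u j)))

  -- A walk around a quadrilateral adds four displacements to an index; the brackets of the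
  -- hypothesis are those of `holonomy`.
  sum₄ : ∀ u {a b c d} → (a ⊕ b) ⊕ (c ⊕ d) ≡ zero → (((u ⊕ a) ⊕ b) ⊕ c) ⊕ d ≡ u
  sum₄ u {a} {b} {c} {d} eq = begin
    (((u ⊕ a) ⊕ b) ⊕ c) ⊕ d       ≡⟨ ⊕-assoc ((u ⊕ a) ⊕ b) c d ⟩
    ((u ⊕ a) ⊕ b) ⊕ (c ⊕ d)       ≡⟨ cong (_⊕ (c ⊕ d)) (⊕-assoc u a b) ⟩
    (u ⊕ (a ⊕ b)) ⊕ (c ⊕ d)       ≡⟨ cancel u eq ⟩
    u                             ∎
    where open ≡-Reasoning

  interchange : ∀ a b c d → (a ⊕ b) ⊕ (c ⊕ d) ≡ (a ⊕ c) ⊕ (b ⊕ d)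
  interchange a b c d = begin
    (a ⊕ b) ⊕ (c ⊕ d)   ≡⟨ ⊕-assoc (a ⊕ b) c d ⟨
    ((a ⊕ b) ⊕ c) ⊕ d   ≡⟨ cong (_⊕ d) (⊕-swap a b c) ⟩
    ((a ⊕ c) ⊕ b) ⊕ d   ≡⟨ ⊕-assoc (a ⊕ c) b d ⟩
    (a ⊕ c) ⊕ (b ⊕ d)   ∎
    where open ≡-Reasoning

  adjacent : ∀ {a b c d} → a ⊕ b ≡ zero → c ⊕ d ≡ zero → (a ⊕ b) ⊕ (c ⊕ d) ≡ zero
  adjacent p q = trans (cong₂ _⊕_ p q) (⊕-identityʳ zero)

  -- This is why every quadruple (a , b , - a , - b) is admissible: the displacements along opposite
  -- edges cancel.
  crossing : ∀ {a b c d} → a ⊕ c ≡ zero → b ⊕ d ≡ zero → (a ⊕ b) ⊕ (c ⊕ d) ≡ zero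
  crossing {a} {b} {c} {d} p q = trans (interchange a b c d) (adjacent p q)

  -- (false , k) stands for k + 1 and (true , k) for - (k + 1).
  Label : Set
  Label = Bool × Fin m

  -- The residue of - (k + 1) is 2m - k, so the negative labels fill the upper half of 1, ..., 2m in
  -- reverse order.
  code : Label → Fin m ⊎ Fin m
  code (false , k) = inj₁ k
  code (true  , k) = inj₂ (opposite k)

  uncode : Fin m ⊎ Fin m → Label
  uncode (inj₁ k) = false , k
  uncode (inj₂ k) = true , opposite k

  uncode-code : ∀ l → uncode (code l) ≡ l
  uncode-code (false , k) = refl
  uncode-code (true  , k) = cong (true ,_) (opposite-involutive k)

  code-uncode : ∀ x → code (uncode x) ≡ x
  code-uncode (inj₁ k) = refl
  code-uncode (inj₂ k) = cong inj₂ (opposite-involutive k)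

  label : Fin (m + m) → Label
  label = uncode ∘ splitAt m

  opp : Label → Label
  opp (s , k) = not s , k

  opaque
    val : Label → Fin N
    val l = suc (join m m (code l))

    val-label : ∀ x → val (label x) ≡ suc x
    val-label x = cong suc (trans (cong (join m m) (code-uncode (splitAt m x))) (join-splitAt m m x))

    label-val : ∀ l → label (join m m (code l)) ≡ l
    label-val l = trans (cong uncode (splitAt-join m m (code l))) (uncode-code l)

    val-injective : ∀ {l l′} → val l ≡ val l′ → l ≡ l′
    val-injective {l} {l′} eq with join m m (code l) in p | eq
    ... | _ | refl = trans (sym (label-val l)) (trans (cong label p) (label-val l′))

    toℕ-val⁺ : ∀ k → toℕ (val (false , k)) ≡ suc (toℕ k)
    toℕ-val⁺ k = cong suc (toℕ-↑ˡ k m)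

    toℕ-val⁻ : ∀ k → toℕ (val (true , k)) ≡ suc (m + (m ∸ suc (toℕ k)))
    toℕ-val⁻ k = cong suc (trans (toℕ-↑ʳ m (opposite k)) (cong (m +_) (opposite-prop k)))

    val-opp : ∀ l → val l ⊕ val (opp l) ≡ zero
    val-opp (false , k) = trans (⊕-def _ _) (trans (cong (_mod N) sum) N-mod)
      where
      open ≡-Reasoning
      sum : toℕ (val (false , k)) + toℕ (val (true , k)) ≡ N
      sum = begin
        toℕ (val (false , k)) + toℕ (val (true , k))      ≡⟨ cong₂ _+_ (toℕ-val⁺ k) (toℕ-val⁻ k) ⟩
        suc (toℕ k) + suc (m + (m ∸ suc (toℕ k)))         ≡⟨ ℕ.+-suc (suc (toℕ k)) _ ⟩
        suc (suc (toℕ k) + (m + (m ∸ suc (toℕ k))))       ≡⟨ cong suc (ℕ.+-comm (suc (toℕ k)) _) ⟩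
        suc ((m + (m ∸ suc (toℕ k))) + suc (toℕ k))       ≡⟨ cong suc (ℕ.+-assoc m _ _) ⟩
        suc (m + ((m ∸ suc (toℕ k)) + suc (toℕ k)))       ≡⟨ cong (λ x → suc (m + x)) (ℕ.m∸n+n≡m (toℕ<n k)) ⟩
        N                                                 ∎
    val-opp (true , k) = trans (⊕-comm (val (true , k)) _) (val-opp (false , k))

    val≢zero : ∀ l → val l ≢ zero
    val≢zero _ ()

  -- The admissibility condition a + c = b + d on labels of one sign; an index is one less than its
  -- label, which shifts both sides by 2. The signs alternate because every second edge is traversed
  -- from black to white.
  square : ∀ s {i j k l} → toℕ i + toℕ k ≡ toℕ j + toℕ l →
           (val (s , i) ⊕ val (not s , j)) ⊕ (val (s , k) ⊕ val (not s , l)) ≡ zero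
  square false {i} {j} {k} {l} eq = begin
    (val (false , i) ⊕ val (true , j)) ⊕ (val (false , k) ⊕ val (true , l))  ≡⟨ interchange _ _ _ _ ⟩
    (val (false , i) ⊕ val (false , k)) ⊕ (val (true , j) ⊕ val (true , l))  ≡⟨ cong (_⊕ _) sum ⟩
    (val (false , j) ⊕ val (false , l)) ⊕ (val (true , j) ⊕ val (true , l))  ≡⟨ crossing (val-opp (false , j)) (val-opp (false , l)) ⟩
    zero                                                                     ∎
    where
    open ≡-Reasoning
    val⁺-+ : ∀ i k → val (false , i) ⊕ val (false , k) ≡ suc (suc (toℕ i + toℕ k)) mod N
    val⁺-+ i k = trans (⊕-def _ _) (cong (_mod N)
      (trans (cong₂ _+_ (toℕ-val⁺ i) (toℕ-val⁺ k)) (cong suc (ℕ.+-suc (toℕ i) (toℕ k)))))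
    sum : val (false , i) ⊕ val (false , k) ≡ val (false , j) ⊕ val (false , l)
    sum = trans (val⁺-+ i k) (trans (cong (λ x → suc (suc x) mod N) eq) (sym (val⁺-+ j l)))
  square true {i} {j} {k} {l} eq = trans (cong₂ _⊕_ (⊕-comm _ _) (⊕-comm _ _)) (square false {j} {i} {l} {k} (sym eq))

  -- Ends of edges are white (false) or black (true): b_{i+a} is w_i's neighbour along a, and w_{j-a} is b_j's.
  weight : Bool → Label → Fin N
  weight e (s , k) = val (s xor e , k)

  move : Bool → Label → Fin N → Fin N
  move e l u = u ⊕ weight e l

  -- Off the deleted matching j - i is nonzero, hence the value of a label; this supplies
  -- coordinates for the edges.
  between : ∀ {i j} → i ≢ j → Σ Label (λ l → move false l i ≡ j)
  between {i} {j} i≢j = go (j ⊕ neg i) i⊕d≡j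
    where
    i⊕d≡j : i ⊕ (j ⊕ neg i) ≡ j
    i⊕d≡j = trans (⊕-comm i _) (trans (⊕-swap j (neg i) i) (cancel j (neg-inverse i)))
    go : ∀ d → i ⊕ d ≡ j → Σ Label (λ l → move false l i ≡ j)
    go zero    eq = ⊥-elim (i≢j (trans (sym (⊕-identityʳ i)) eq))
    go (suc x) eq = l , trans (cong (λ s → i ⊕ val (s , proj₂ l)) (xor-identityʳ (proj₁ l)))
                              (trans (cong (i ⊕_) (val-label x)) eq)
      where l = label x

  move-back : ∀ e l u → move (not e) l (move e l u) ≡ u
  move-back false (false , k) u = cancel u (val-opp (false , k))
  move-back false (true  , k) u = cancel u (val-opp (true , k))
  move-back true  (false , k) u = cancel u (val-opp (true , k))
  move-back true  (true  , k) u = cancel u (val-opp (false , k))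

  move-injective : ∀ e {l l′} u → move e l u ≡ move e l′ u → l ≡ l′
  move-injective e {s , k} {s′ , k′} u eq with val-injective {s xor e , k} {s′ xor e , k′} (⊕-cancelˡ u eq)
  move-injective false {false , k} {false , k′} u eq | refl = refl
  move-injective false {true , k} {true , k′} u eq | refl = refl
  move-injective true  {false , k} {false , k′} u eq | refl = refl
  move-injective true  {true , k} {true , k′} u eq | refl = refl

  -- If 2a = 0 then a = - a, but opposite labels differ in sign. Consecutive edges at infinity are
  -- distinct for this reason.
  ⊕-⊕-val≢ : ∀ u l → (u ⊕ val l) ⊕ val l ≢ u
  ⊕-⊕-val≢ u l eq with val-injective {l} {opp l} (⊕-cancelˡ (u ⊕ val l) (trans eq (sym (cancel u (val-opp l)))))
  ⊕-⊕-val≢ u (false , _) eq | ()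
  ⊕-⊕-val≢ u (true  , _) eq | ()

  move≢ : ∀ e l u → move e l u ≢ u
  move≢ e (s , k) u eq = val≢zero (s xor e , k) (⊕-cancelˡ u (trans eq (sym (⊕-identityʳ u))))

  times : ℕ → Fin N → Fin N
  times zero    a = zero
  times (suc c) a = a ⊕ times c a

  times-mod : ∀ c b → times c (b mod N) ≡ (c * b) mod N
  times-mod zero    b = refl
  times-mod (suc c) b = trans (cong ((b mod N) ⊕_) (times-mod c b)) (mod-+ b (c * b))

  -- `c` inverts `b` modulo N, so `a` generates ℤ_N.
  times-generator : ∀ {a} b c → a ≡ b mod N → c * b ≡ 1 + N → ∀ v → times (toℕ v * c) a ≡ v
  times-generator {a} b c a≡b cb≡1 v = begin
    times (toℕ v * c) a              ≡⟨ cong (times (toℕ v * c)) a≡b ⟩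
    times (toℕ v * c) (b mod N)      ≡⟨ times-mod (toℕ v * c) b ⟩
    (toℕ v * c * b) mod N            ≡⟨ cong (_mod N) (trans (ℕ.*-assoc (toℕ v) c b)
                                                          (trans (cong (toℕ v *_) cb≡1) (ℕ.*-suc (toℕ v) N))) ⟩
    (toℕ v + toℕ v * N) mod N        ≡⟨ toℕ-injective (trans (toℕ-mod (toℕ v + toℕ v * N))
                                          (trans ([m+kn]%n≡m%n (toℕ v) (toℕ v) N) (sym (toℕ-mod (toℕ v))))) ⟩
    toℕ v mod N                      ≡⟨ mod-toℕ v ⟩
    v                                ∎
    where open ≡-Reasoning

  -- Shifting N times by the same amount is the identity, and N is odd.
  no-alternating-shift : ∀ (f : Fin N → Bool) a → ¬ (∀ u → f (u ⊕ a) ≡ not (f u))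
  no-alternating-shift f a alt = not-¬ {f zero} refl (begin
      f zero                         ≡⟨ cong f (trans (cong (zero ⊕_) timesN) (⊕-identityʳ zero)) ⟨
      f (zero ⊕ times N a)           ≡⟨ shift N zero ⟩
      iter not N (f zero)            ≡⟨ cong not (even m) ⟩
      not (f zero)                   ∎)
    where
    open ≡-Reasoning
    shift : ∀ c u → f (u ⊕ times c a) ≡ iter not c (f u)
    shift zero    u = cong f (⊕-identityʳ u)
    shift (suc c) u = begin
      f (u ⊕ (a ⊕ times c a))        ≡⟨ cong f (⊕-assoc u a _) ⟨
      f ((u ⊕ a) ⊕ times c a)        ≡⟨ cong f (⊕-swap u a _) ⟩
      f ((u ⊕ times c a) ⊕ a)        ≡⟨ alt _ ⟩
      not (f (u ⊕ times c a))        ≡⟨ cong not (shift c u) ⟩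
      not (iter not c (f u))         ∎
    even : ∀ c {b} → iter not (c + c) b ≡ b
    even zero    = refl
    even (suc c) {b} = trans (cong (λ x → not (iter not x b)) (ℕ.+-suc c c)) (trans (not-involutive _) (even c))
    timesN : times N a ≡ zero
    timesN = begin
      times N a                      ≡⟨ cong (times N) (mod-toℕ a) ⟨
      times N (toℕ a mod N)          ≡⟨ times-mod N (toℕ a) ⟩
      (N * toℕ a) mod N              ≡⟨ toℕ-injective (trans (toℕ-mod (N * toℕ a))
                                          (trans (cong (_% N) (ℕ.*-comm N (toℕ a))) (m*n%n≡0 (toℕ a) N))) ⟩
      zero                           ∎

-- Combinatorial maps in coordinates and their translation into embeddings.

module _ {A : Set} (t₁ t₂ : A → A) where

  Step : A → A → Set
  Step x y = y ≡ t₁ x ⊎ y ≡ t₂ x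

  Step-sym : (∀ x → t₁ (t₁ x) ≡ x) → (∀ x → t₂ (t₂ x) ≡ x) → ∀ {x y} → Step x y → Step y x
  Step-sym i₁ i₂ (inj₁ refl) = inj₁ (sym (i₁ _))
  Step-sym i₁ i₂ (inj₂ refl) = inj₂ (sym (i₂ _))

data Gen : Set where
  g₀ g₁ g₂ : Gen

-- A map given in coordinates X for the flags. The field t₁-nbr (consecutive edges at a vertex have
-- different far ends) excludes faces of length less than 4.
record Model (n : ℕ) : Set₁ where
  field
    X        : Set
    t₀ t₁ t₂ : X → X
    vx       : X → Vertex n
    to       : Flag n → X
    from     : X → Flag n
    to-from  : ∀ x → to (from x) ≡ x
    from-to  : ∀ f → from (to f) ≡ f
    from-t₀  : ∀ x → τ₀ (from x) ≡ from (t₀ x)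
    from-t₂  : ∀ x → τ₂ (from x) ≡ from (t₂ x)
    from-vx  : ∀ x → vertexOf (from x) ≡ vx x
    t₁-invol : ∀ x → t₁ (t₁ x) ≡ x
    t₁-vx    : ∀ x → vx (t₁ x) ≡ vx x
    t₁-nbr   : ∀ x → vx (t₀ (t₁ x)) ≢ vx (t₀ x)
    base     : Vertex n → X
    reach    : ∀ x → Star (Step t₁ t₂) x (base (vx x))
    face     : ∀ x → iter (t₀ ∘ t₁) 4 x ≡ x

  act : Gen → X → X
  act g₀ = t₀
  act g₁ = t₁
  act g₂ = t₂

  -- The last letter acts first.
  run : List Gen → X → X
  run w x = foldr act x w

  Alternating : (X → Bool) → Set
  Alternating c = ∀ g x → c (act g x) ≡ not (c x)

  run-alternates : ∀ {c} → Alternating c → ∀ w x → c (run w x) ≡ iter not (length w) (c x)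
  run-alternates alt []      x = refl
  run-alternates alt (g ∷ w) x = trans (alt g (run w x)) (cong not (run-alternates alt w x))

module _ {n : ℕ} (M : Model n) where
  open Model M

  private
    τ : Flag n → Flag n
    τ f = from (t₁ (to f))

    τ-from : ∀ x → τ (from x) ≡ from (t₁ x)
    τ-from x = cong (from ∘ t₁) (to-from x)

    -- Reduces a claim about flags to those of the form `from x`, where the involutions are computed
    -- in coordinates.
    via : ∀ {P : Flag n → Set} → (∀ x → P (from x)) → ∀ f → P f
    via {P} p f = subst P (from-to f) (p (to f))

    from-injective : ∀ {x y} → from x ≡ from y → x ≡ y
    from-injective {x} {y} eq = trans (sym (to-from x)) (trans (cong to eq) (to-from y))

    t₂-invol : ∀ x → t₂ (t₂ x) ≡ x
    t₂-invol x = from-injective (begin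
      from (t₂ (t₂ x))     ≡⟨ from-t₂ (t₂ x) ⟨
      τ₂ (from (t₂ x))     ≡⟨ cong τ₂ (from-t₂ x) ⟨
      τ₂ (τ₂ (from x))     ≡⟨ cong (λ b → record (from x) { side = b }) (not-involutive (side (from x))) ⟩
      from x               ∎)
      where open ≡-Reasoning

    step : ∀ {x y} → Step t₁ t₂ x y → VStep τ (from x) (from y)
    step {x} (inj₁ refl) = subst (VStep τ (from x)) (τ-from x) (by-τ₁ (from x))
    step {x} (inj₂ refl) = subst (VStep τ (from x)) (from-t₂ x) (by-τ₂ (from x))

    τ-nbr : ∀ f → vertexOf (τ₀ (τ f)) ≢ vertexOf (τ₀ f)
    τ-nbr = via {λ f → vertexOf (τ₀ (τ f)) ≢ vertexOf (τ₀ f)} λ x eq → t₁-nbr x (begin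
      vx (t₀ (t₁ x))                      ≡⟨ from-vx _ ⟨
      vertexOf (from (t₀ (t₁ x)))         ≡⟨ cong vertexOf (from-t₀ _) ⟨
      vertexOf (τ₀ (from (t₁ x)))         ≡⟨ cong (vertexOf ∘ τ₀) (τ-from x) ⟨
      vertexOf (τ₀ (τ (from x)))          ≡⟨ eq ⟩
      vertexOf (τ₀ (from x))              ≡⟨ cong vertexOf (from-t₀ x) ⟩
      vertexOf (from (t₀ x))              ≡⟨ from-vx _ ⟩
      vx (t₀ x)                           ∎)
      where open ≡-Reasoning

    τ-vertex : ∀ f → vertexOf (τ f) ≡ vertexOf f
    τ-vertex = via {λ f → vertexOf (τ f) ≡ vertexOf f} λ x →
      trans (cong vertexOf (τ-from x)) (trans (from-vx _) (trans (t₁-vx x) (sym (from-vx x))))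

    -- Both flags reach the base flag of their common vertex, and the second path can be reversed
    -- because the steps are involutions.
    connected : ∀ x y → vx x ≡ vx y → Star (Step t₁ t₂) x y
    connected x y eq = reach x ◅◅ subst (λ v → Star (Step t₁ t₂) (base v) y) (sym eq)
      (reverse (Step-sym t₁ t₂ t₁-invol t₂-invol) (reach y))

  embedding : Embedding n
  embedding = record
    { τ₁                = τ
    ; τ₁-invol          = λ f → trans (τ-from _) (trans (cong from (t₁-invol _)) (from-to f))
    ; τ₁-fpf            = λ f eq → τ-nbr f (cong (vertexOf ∘ τ₀) eq)
    ; τ₁-vertex         = τ-vertex
    ; vertex-transitive = λ f g eq → subst₂ (Star (VStep τ)) (from-to f) (from-to g)
        (gmap from step (connected (to f) (to g) (trans (vx-to f) (trans eq (sym (vx-to g))))))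
    }
    where
    vx-to : ∀ f → vx (to f) ≡ vertexOf f
    vx-to f = trans (sym (from-vx (to f))) (cong vertexOf (from-to f))

  private
    ρ-from : ∀ x → ρ embedding (from x) ≡ from (t₀ (t₁ x))
    ρ-from x = trans (cong τ₀ (τ-from x)) (from-t₀ _)

    ρ-iter : ∀ k x → iter (ρ embedding) k (from x) ≡ from (iter (t₀ ∘ t₁) k x)
    ρ-iter zero    x = refl
    ρ-iter (suc k) x = trans (cong (ρ embedding) (ρ-iter k x)) (ρ-from _)

    end : Flag n → Bool
    end f = proj₁ (vertexOf f)

    end-τ₀ : ∀ f → end (τ₀ f) ≡ not (end f)
    end-τ₀ (flag _ _ _ false _) = refl
    end-τ₀ (flag _ _ _ true  _) = refl

    τ₀-invol : ∀ (f : Flag n) → τ₀ (τ₀ f) ≡ f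
    τ₀-invol (flag _ _ _ false _) = refl
    τ₀-invol (flag _ _ _ true  _) = refl

    end-ρ : ∀ f → end (ρ embedding f) ≡ not (end f)
    end-ρ f = trans (end-τ₀ (τ f)) (cong (not ∘ proj₁) (τ-vertex f))

    -- The graph is bipartite, and each step along a face changes the colour.
    ρ≢ : ∀ f → ρ embedding f ≢ f
    ρ≢ f eq = not≢ (trans (sym (end-ρ f)) (cong end eq))

  quadrangular : Quadrangular embedding
  quadrangular f = closed f , proper
    where
    R : Flag n → Flag n
    R = ρ embedding
    closed : ∀ f → iter R 4 f ≡ f
    closed = via {λ f → iter R 4 f ≡ f} λ x → trans (ρ-iter 4 x) (cong from (face x))
    proper : ∀ k → 0 < k → k < 4 → iter R k f ≢ f
    proper 1 _ _ eq = ρ≢ f eq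
    -- In a face of length 2 the edges of `R f` and `τ (R f)` would have the same far end, namely
    -- the vertex of `f`.
    proper 2 _ _ eq = τ-nbr (R f) (trans (cong vertexOf eq)
      (sym (trans (cong vertexOf (τ₀-invol (τ f))) (τ-vertex f))))
    -- Periods 3 and 4 together would give period 1.
    proper 3 _ _ eq = ρ≢ f (trans (cong R (sym eq)) (closed f))
    proper (suc (suc (suc (suc _)))) _ (s≤s (s≤s (s≤s (s≤s ()))))

  nonorientable : (∀ c → ¬ Alternating c) → Nonorientable embedding
  nonorientable no (c , alt) = no (c ∘ from) alternating
    where
    alternating : Alternating (c ∘ from)
    alternating g₀ x = trans (cong c (sym (from-t₀ x))) (¬-not (proj₁ (alt (from x))))
    alternating g₁ x = trans (cong c (sym (τ-from x))) (¬-not (proj₁ (proj₂ (alt (from x)))))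
    alternating g₂ x = trans (cong c (sym (from-t₂ x))) (¬-not (proj₂ (proj₂ (alt (from x)))))

module _ (m : ℕ) {n : ℕ} (M : Model n) where
  open Cyclic m
  open Model M

  -- The hypothesis on `iter not` says that `w` has odd length, in a form that `refl` settles for
  -- concrete words.
  twisted : (x : Fin N → X) (w : List Gen) (a : Fin N) →
            (∀ b → iter not (length w) b ≡ not b) → (∀ u → run w (x u) ≡ x (u ⊕ a)) →
            ∀ c → ¬ Alternating c
  twisted x w a odd shift c alt = no-alternating-shift (λ u → c (x u)) a λ u →
    trans (cong c (sym (shift u))) (trans (run-alternates alt w (x u)) (odd (c (x u))))

module Links {A : Set} (τ : A × Bool → A × Bool) (τ-invol : ∀ p → τ (τ p) ≡ p) where

  flip : A × Bool → A × Bool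
  flip (l , d) = l , not d

  flip-invol : ∀ p → flip (flip p) ≡ p
  flip-invol (l , d) = cong (l ,_) (not-involutive d)

  infix 4 _~_
  -- Quantifying over both sides makes this a relation between whole edges: `flip` comes for free
  -- and only the corners given by `τ` have to be listed.
  _~_ : A → A → Set
  l ~ l′ = ∀ d d′ → Star (Step τ flip) (l , d) (l′ , d′)

  ~-refl : ∀ {l} → l ~ l
  ~-refl false false = ε
  ~-refl false true  = inj₂ refl ◅ ε
  ~-refl true  false = inj₂ refl ◅ ε
  ~-refl true  true  = ε

  infixr 5 _⟫_
  _⟫_ : ∀ {a b c} → a ~ b → b ~ c → a ~ c
  (p ⟫ q) d d′ = p d false ◅◅ q false d′

  ~-sym : ∀ {a b} → a ~ b → b ~ a
  ~-sym p d d′ = reverse (Step-sym τ flip τ-invol flip-invol) (p d′ d)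

  link : ∀ {l d l′ d′} → τ (l , d) ≡ (l′ , d′) → l ~ l′
  link {d = d} {d′ = d′} eq c c′ = ~-refl c d ◅◅ inj₁ (sym eq) ◅ ~-refl d′ c′

flag-cong : ∀ {n} {i i′ j j′ : Fin n} {p : False (i ≟ j)} {p′ : False (i′ ≟ j′)} {e d} →
            i ≡ i′ → j ≡ j′ → flag i j p e d ≡ flag i′ j′ p′ e d
flag-cong {p = p} {p′} refl refl = cong (λ q → flag _ _ q _ _) (T-irrelevant p p′)

-- Maps on N + N vertices invariant under ℤ_N.

module Schemes (m : ℕ) where
  open Cyclic m

  private
    off : ∀ u l → False (u ≟ move false l u)
    off u l = fromWitnessFalse (λ eq → move≢ false l u (sym eq))

    off′ : ∀ u l → False (move true l u ≟ u)
    off′ u l = fromWitnessFalse (move≢ true l u)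

  Slot : Set
  Slot = Label × Bool

  -- The total displacement around the face that starts at the slot p of a vertex of colour e.
  holonomy : (Bool → Slot → Slot) → Bool → Slot → Fin N
  holonomy σ e p =
    let q = σ e p ; r = σ (not e) q ; t = σ e r in
    (weight e (proj₁ q) ⊕ weight (not e) (proj₁ r)) ⊕ (weight e (proj₁ t) ⊕ weight (not e) (proj₁ p))

  -- A slot is a label with a side of the edges carrying it; σ e pairs the slots that share a corner at
  -- the vertices of colour e.
  record Scheme : Set where
    field
      σ       : Bool → Slot → Slot
      σ-invol : ∀ e p → σ e (σ e p) ≡ p
      σ-label : ∀ e p → proj₁ (σ e p) ≢ proj₁ p
      origin  : Slot
      reach   : ∀ e p → Star (Step (σ e) (λ (l , d) → l , not d)) p origin
      closes  : ∀ e p → σ (not e) (σ e (σ (not e) (σ e p))) ≡ p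
      flat    : ∀ e p → holonomy σ e p ≡ zero

  -- An edge has the same slots at both ends, so `t₀` changes only the colour and the index, and
  -- translating the index commutes with all three involutions.
  schemeModel : Scheme → Model N
  schemeModel S = record
    { X = X ; t₀ = t₀ ; t₁ = t₁ ; t₂ = t₂ ; vx = λ (e , u , _) → e , u
    ; to = to ; from = from ; to-from = to-from ; from-to = from-to
    ; from-t₀ = from-t₀ ; from-t₂ = from-t₂ ; from-vx = from-vx
    ; t₁-invol = λ (e , u , p) → cong (λ q → e , u , q) (σ-invol e p)
    ; t₁-vx = λ _ → refl
    ; t₁-nbr = λ (e , u , p) eq → σ-label e p (move-injective e u (cong proj₂ eq))
    ; base = λ (e , u) → e , u , origin
    ; reach = λ (e , u , p) → gmap (λ q → e , u , q) step (reach e p)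
    ; face = λ (e , u , p) → cycle e u p
    }
    where
    open Scheme S
    X : Set
    X = Bool × Fin N × Slot
    t₀ t₁ t₂ : X → X
    t₀ (e , u , (l , d)) = not e , move e l u , (l , d)
    t₁ (e , u , p) = e , u , σ e p
    t₂ (e , u , (l , d)) = e , u , (l , not d)
    from : X → Flag N
    from (false , u , (l , d)) = flag u (move false l u) (off u l) false d
    from (true  , u , (l , d)) = flag (move true l u) u (off′ u l) true d
    lab : ∀ {i j} → False (i ≟ j) → Σ Label λ l → move false l i ≡ j
    lab p = between (toWitnessFalse p)
    to : Flag N → X
    to (flag i j p false d) = false , i , (proj₁ (lab p) , d)
    to (flag i j p true  d) = true  , j , (proj₁ (lab p) , d)
    to-from : ∀ x → to (from x) ≡ x
    to-from (false , u , (l , d)) = cong (λ l → false , u , (l , d)) (move-injective false u (proj₂ (lab (off u l))))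
    to-from (true  , u , (l , d)) = cong (λ l → true , u , (l , d))
      (move-injective false (move true l u) (trans (proj₂ (lab (off′ u l))) (sym (move-back true l u))))
    from-to : ∀ f → from (to f) ≡ f
    from-to (flag i j p false d) = flag-cong refl (proj₂ (lab p))
    from-to (flag i j p true  d) = flag-cong
      (trans (cong (move true (proj₁ (lab p))) (sym (proj₂ (lab p)))) (move-back false (proj₁ (lab p)) i)) refl
    from-t₀ : ∀ x → τ₀ (from x) ≡ from (t₀ x)
    from-t₀ (false , u , (l , d)) = flag-cong (sym (move-back false l u)) refl
    from-t₀ (true  , u , (l , d)) = flag-cong refl (sym (move-back true l u))
    from-t₂ : ∀ x → τ₂ (from x) ≡ from (t₂ x)
    from-t₂ (false , _) = refl
    from-t₂ (true  , _) = refl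
    from-vx : ∀ x → vertexOf (from x) ≡ (proj₁ x , proj₁ (proj₂ x))
    from-vx (false , _) = refl
    from-vx (true  , _) = refl
    step : ∀ {e u p q} → Step (σ e) (λ (l , d) → l , not d) p q → Step t₁ t₂ (e , u , p) (e , u , q)
    step (inj₁ refl) = inj₁ refl
    step (inj₂ refl) = inj₂ refl
    -- The fourth displacement is read off the slot reached at the end; `closes` identifies that
    -- slot with `p`, as `holonomy` presupposes.
    last : ∀ {e u v} {p q : Slot} → q ≡ p → move e (proj₁ p) v ≡ u → move e (proj₁ q) v ≡ u
    last refl eq = eq
    cycle : ∀ e u p → iter (t₀ ∘ t₁) 4 (e , u , p) ≡ (e , u , p)
    cycle false u p = cong₂ (λ v q → false , v , q) (last {true} (closes false p) (sum₄ u (flat false p))) (closes false p)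
    cycle true  u p = cong₂ (λ v q → true , v , q) (last {false} (closes true p) (sum₄ u (flat true p))) (closes true p)

-- Odd n at least 9.

module OddLarge (K : ℕ) where

  m : ℕ
  m = 4 + K

  open Cyclic m
  open Schemes m

  -- #0, #1, #2 carry ±1, ±2, ±3, and #z k carries the chain element ±(4 + k).
  pattern #0 = zero
  pattern #1 = suc zero
  pattern #2 = suc (suc zero)
  pattern #z k = suc (suc (suc k))

  -- The chain face of consecutive labels x, y uses the side `true` of x and the side `false` of y.
  -- The last label m has its side `true` in (m , -1 , -m , 1).
  onward : Bool → {k : Fin (suc K)} → View k → Slot
  onward s ‵fromℕ            = (not s , #0) , true
  onward s (‵inj₁ {i = i} _) = (s , #z (suc i)) , false

  -- On the sides false, s xor e tells the two kinds of corners of (2 , 4 , 3 , 1) apart, and since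
  -- (-3 , -4 , -2 , -1) is that quadruple negated with the colours exchanged, it serves both.
  σ : Bool → Slot → Slot
  σ e ((s , #z k)       , true)  = onward (s xor e) (view k)
  σ e ((s , #0)         , false) = (s , (if s xor e then #1 else #2)) , false
  σ e ((s , #1)         , false) = (s , (if s xor e then #0 else #z zero)) , false
  σ e ((s , #2)         , false) = (s , (if s xor e then #z zero else #0)) , false
  σ e ((s , #z zero)    , false) = (s , (if s xor e then #2 else #1)) , false
  σ e ((s , #z (suc k)) , false) = (s xor e , #z (inject₁ k)) , true
  σ e ((s , #0)         , true)  = (not (s xor e) , #z (fromℕ K)) , true
  σ e ((s , #1)         , true)  = (s xor e , #2) , true
  σ e ((s , #2)         , true)  = (s xor e , #1) , true

  σ-top : ∀ e s → σ e ((s , #z (fromℕ K)) , true) ≡ ((not (s xor e) , #0) , true)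
  σ-top e s = cong (onward (s xor e)) (view-fromℕ K)

  σ-chain : ∀ e s (k : Fin K) → σ e ((s , #z (inject₁ k)) , true) ≡ ((s xor e , #z (suc k)) , false)
  σ-chain e s k = cong (onward (s xor e)) (view-inject₁ k)

  record Good (e : Bool) (p : Slot) : Set where
    constructor mkGood
    field
      invol  : σ e (σ e p) ≡ p
      moves  : proj₁ (σ e p) ≢ proj₁ p
      closes : σ (not e) (σ e (σ (not e) (σ e p))) ≡ p
      flat   : holonomy σ e p ≡ zero

  -- `p`, `q`, `r`, `t` are the slots met on one trip around a face; naming them settles all
  -- conditions at `p` together.
  good-by : ∀ {e p q r t} → σ e p ≡ q → σ e q ≡ p → σ (not e) q ≡ r → σ e r ≡ t → σ (not e) t ≡ p →
            proj₁ q ≢ proj₁ p →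
            (weight e (proj₁ q) ⊕ weight (not e) (proj₁ r)) ⊕ (weight e (proj₁ t) ⊕ weight (not e) (proj₁ p)) ≡ zero →
            Good e p
  good-by refl inv refl refl closes label weights = mkGood inv label closes weights

  weight-opp : ∀ e l → weight e l ⊕ weight e (opp l) ≡ zero
  weight-opp false (false , k) = val-opp (false , k)
  weight-opp false (true  , k) = val-opp (true , k)
  weight-opp true  (false , k) = val-opp (true , k)
  weight-opp true  (true  , k) = val-opp (false , k)

  -- x = true occurs in the face (m , -1 , -m , 1) only, whose first two labels have different signs.
  good-± : ∀ x e s {k d k′ d′} → k′ ≢ k →
           (∀ e s → σ e ((s , k) , d) ≡ ((x xor (s xor e) , k′) , d′)) →
           (∀ e s → σ e ((s , k′) , d′) ≡ ((x xor (s xor e) , k) , d)) →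
           Good e ((s , k) , d)
  -- The third and fourth slots are the first two with opposite signs, since the factors `xor e` and
  -- `xor (not e)` combine to one negation. The eight cases let the signs compute.
  good-± false false false {k} {k′ = k′} ≢ there back =
    good-by (there _ _) (back _ _) (back _ _) (there _ _) (back _ _) (≢ ∘ cong proj₂)
      (crossing (weight-opp false (false , k′)) (weight-opp true (true , k)))
  good-± false false true  {k} {k′ = k′} ≢ there back =
    good-by (there _ _) (back _ _) (back _ _) (there _ _) (back _ _) (≢ ∘ cong proj₂)
      (crossing (weight-opp false (true , k′)) (weight-opp true (false , k)))
  good-± false true  false {k} {k′ = k′} ≢ there back =
    good-by (there _ _) (back _ _) (back _ _) (there _ _) (back _ _) (≢ ∘ cong proj₂)
      (crossing (weight-opp true (true , k′)) (weight-opp false (true , k)))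
  good-± false true  true  {k} {k′ = k′} ≢ there back =
    good-by (there _ _) (back _ _) (back _ _) (there _ _) (back _ _) (≢ ∘ cong proj₂)
      (crossing (weight-opp true (false , k′)) (weight-opp false (false , k)))
  good-± true  false false {k} {k′ = k′} ≢ there back =
    good-by (there _ _) (back _ _) (back _ _) (there _ _) (back _ _) (≢ ∘ cong proj₂)
      (crossing (weight-opp false (true , k′)) (weight-opp true (true , k)))
  good-± true  false true  {k} {k′ = k′} ≢ there back =
    good-by (there _ _) (back _ _) (back _ _) (there _ _) (back _ _) (≢ ∘ cong proj₂)
      (crossing (weight-opp false (false , k′)) (weight-opp true (false , k)))
  good-± true  true  false {k} {k′ = k′} ≢ there back =
    good-by (there _ _) (back _ _) (back _ _) (there _ _) (back _ _) (≢ ∘ cong proj₂)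
      (crossing (weight-opp true (false , k′)) (weight-opp false (true , k)))
  good-± true  true  true  {k} {k′ = k′} ≢ there back =
    good-by (there _ _) (back _ _) (back _ _) (there _ _) (back _ _) (≢ ∘ cong proj₂)
      (crossing (weight-opp true (true , k′)) (weight-opp false (false , k)))

  good : ∀ e p → Good e p
  good e ((s , #z k) , true) with view k
  ... | ‵fromℕ     = good-± true e s (λ ()) σ-top (λ _ _ → refl)
  ... | ‵inject₁ i = good-± false e s (inject₁≢suc ∘ sym ∘ suc-injective ∘ suc-injective ∘ suc-injective)
                                         (λ e s → σ-chain e s i) (λ _ _ → refl)
  good e ((s , #z (suc k)) , false) = good-± false e s (inject₁≢suc ∘ suc-injective ∘ suc-injective ∘ suc-injective)
                                         (λ _ _ → refl) (λ e s → σ-chain e s k)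
  good e ((s , #0) , true) = good-± true e s (λ ()) (λ _ _ → refl) σ-top
  good e ((s , #1) , true) = good-± false e s (λ ()) (λ _ _ → refl) (λ _ _ → refl)
  good e ((s , #2) , true) = good-± false e s (λ ()) (λ _ _ → refl) (λ _ _ → refl)
  -- The remaining slots lie in (2 , 4 , 3 , 1) or its negative. Each instance of `square` is 2 + 3
  -- = 4 + 1, read from a different corner.
  good false ((false , #0     ) , false) = good-by refl refl refl refl refl (λ ()) (square false {#2} {#z zero} {#1} {#0} refl)
  good false ((true  , #0     ) , false) = good-by refl refl refl refl refl (λ ()) (square true {#1} {#z zero} {#2} {#0} refl)
  good true  ((false , #0     ) , false) = good-by refl refl refl refl refl (λ ()) (square true {#1} {#z zero} {#2} {#0} refl)
  good true  ((true  , #0     ) , false) = good-by refl refl refl refl refl (λ ()) (square false {#2} {#z zero} {#1} {#0} refl)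
  good false ((false , #1     ) , false) = good-by refl refl refl refl refl (λ ()) (square false {#z zero} {#2} {#0} {#1} refl)
  good false ((true  , #1     ) , false) = good-by refl refl refl refl refl (λ ()) (square true {#0} {#2} {#z zero} {#1} refl)
  good true  ((false , #1     ) , false) = good-by refl refl refl refl refl (λ ()) (square true {#0} {#2} {#z zero} {#1} refl)
  good true  ((true  , #1     ) , false) = good-by refl refl refl refl refl (λ ()) (square false {#z zero} {#2} {#0} {#1} refl)
  good false ((false , #2     ) , false) = good-by refl refl refl refl refl (λ ()) (square false {#0} {#1} {#z zero} {#2} refl)
  good false ((true  , #2     ) , false) = good-by refl refl refl refl refl (λ ()) (square true {#z zero} {#1} {#0} {#2} refl)
  good true  ((false , #2     ) , false) = good-by refl refl refl refl refl (λ ()) (square true {#z zero} {#1} {#0} {#2} refl)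
  good true  ((true  , #2     ) , false) = good-by refl refl refl refl refl (λ ()) (square false {#0} {#1} {#z zero} {#2} refl)
  good false ((false , #z zero) , false) = good-by refl refl refl refl refl (λ ()) (square false {#1} {#0} {#2} {#z zero} refl)
  good false ((true  , #z zero) , false) = good-by refl refl refl refl refl (λ ()) (square true {#2} {#0} {#1} {#z zero} refl)
  good true  ((false , #z zero) , false) = good-by refl refl refl refl refl (λ ()) (square true {#2} {#0} {#1} {#z zero} refl)
  good true  ((true  , #z zero) , false) = good-by refl refl refl refl refl (λ ()) (square false {#1} {#0} {#2} {#z zero} refl)

  module At (e : Bool) = Links (σ e) (λ p → Good.invol (good e p))

  root : Label
  root = false , #z zero

  -- At white vertices the chain preserves signs, and -4 is brought to 4 by climbing to -m and
  -- crossing to 1, 3 and 2. At black vertices signs alternate along the chain, so the induction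
  -- treats both at once.
  reach : ∀ e l → At._~_ e l root
  reach false = λ where
      (s     , #z k) → chain s k ⟫ #z₀~ s
      (s     , #0)   → #0~ s
      (false , #1)   → link {d = false} refl
      (true  , #1)   → link {d = true} refl ⟫ link {d = false} refl ⟫ #z₀⁻~
      (false , #2)   → link {d = true} refl ⟫ link {d = false} refl
      (true  , #2)   → link {d = false} refl ⟫ #z₀⁻~
    where
    open At false
    chain : ∀ s k → (s , #z k) ~ (s , #z zero)
    chain false = <-weakInduction _ ~-refl λ k ih → link {d = false} refl ⟫ ih
    chain true  = <-weakInduction _ ~-refl λ k ih → link {d = false} refl ⟫ ih
    #z₀⁻~ : (true , #z zero) ~ root
    #z₀⁻~ = ~-sym (chain true (fromℕ K)) ⟫ link (σ-top false true)
          ⟫ link {d = false} refl ⟫ link {d = true} refl ⟫ link {d = false} refl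
    #z₀~ : ∀ s → (s , #z zero) ~ root
    #z₀~ false = ~-refl
    #z₀~ true  = #z₀⁻~
    #0~ : ∀ s → (s , #0) ~ root
    #0~ s = link {d = true} refl ⟫ chain (not (s xor false)) (fromℕ K) ⟫ #z₀~ _
  reach true = λ where
      (s     , #z k) → chain s k
      (s     , #0)   → #0~ s
      (true  , #1)   → link {d = false} refl ⟫ chain true zero
      (false , #1)   → link {d = true} refl ⟫ #2⁻~
      (false , #2)   → link {d = false} refl
      (true  , #2)   → #2⁻~
    where
    open At true
    chain : ∀ s k → (s , #z k) ~ root
    chain s k = <-weakInduction (λ k → ∀ s → (s , #z k) ~ root) from-zero
      (λ k ih s → link {d = false} refl ⟫ ih (s xor true)) k s
      where
      from-zero : ∀ s → (s , #z zero) ~ root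
      from-zero false = ~-refl
      from-zero true  = link {d = false} refl ⟫ link {d = true} refl ⟫ link {d = false} refl
    #0~ : ∀ s → (s , #0) ~ root
    #0~ s = link {d = true} refl ⟫ chain (not (s xor true)) (fromℕ K)
    #2⁻~ : (true , #2) ~ root
    #2⁻~ = link {d = false} refl ⟫ #0~ true

  scheme : Scheme
  scheme = record
    { σ       = σ
    ; σ-invol = λ e p → Good.invol (good e p)
    ; σ-label = λ e p → Good.moves (good e p)
    ; origin  = root , false
    ; reach   = λ e (l , d) → reach e l d false
    ; closes  = λ e p → Good.closes (good e p)
    ; flat    = λ e p → Good.flat (good e p)
    }

  result : Σ (Embedding N) (λ E → Quadrangular E × Nonorientable E)
  result = embedding M , quadrangular M , nonorientable M
    -- Two edges of (2 , 4 , 3 , 1) lead from label 2 at w_u through 4 to label 3 at w_{u+4-3}; the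
    -- corner of (2 , 3 , -2 , -3) there leads back to label 2.
    (twisted m M (λ u → false , u , (false , #1) , false) (g₂ ∷ g₁ ∷ g₂ ∷ g₀ ∷ g₁ ∷ g₀ ∷ g₁ ∷ [])
      (weight false (false , #z zero) ⊕ weight true (false , #2)) (λ { false → refl ; true → refl })
      (λ u → cong (λ v → false , v , (false , #1) , false) (⊕-assoc u _ _)))
    where
    M = schemeModel scheme

-- The case n = 7, by exhaustive check.

∀Bool? : {P : Bool → Set} → Decidable P → Dec (∀ b → P b)
∀Bool? P? = map′ (λ { (f , t) false → f ; (f , t) true → t }) (λ p → p false , p true) (P? false ×-dec P? true)

module OddSeven where

  open Cyclic 3
  open Schemes 3

  ∀Slot? : {P : Slot → Set} → Decidable P → Dec (∀ p → P p)
  ∀Slot? P? = map′ (λ p ((s , k) , d) → p s k d) (λ p s k d → p ((s , k) , d))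
    (∀Bool? λ s → Fin.all? λ k → ∀Bool? λ d → P? ((s , k) , d))

  _≟ᴸ_ : (l l′ : Label) → Dec (l ≡ l′)
  _≟ᴸ_ = ≡-dec Bool._≟_ _≟_

  _≟ˢ_ : (p q : Slot) → Dec (p ≡ q)
  _≟ˢ_ = ≡-dec _≟ᴸ_ Bool._≟_

  pattern ⁺1 = (false , 0F)
  pattern ⁺2 = (false , 1F)
  pattern ⁺3 = (false , 2F)
  pattern ⁻1 = (true , 0F)
  pattern ⁻2 = (true , 1F)
  pattern ⁻3 = (true , 2F)

  -- The first and second occurrence of a label in (1 , 3 , 1 , -1), (2 , -2 , 2 , -1), (3 , -3 , -2
  -- , -3), read in this order, are its sides `false` and `true`.
  σ : Bool → Slot → Slot
  σ false (⁺1 , false) = ⁺3 , false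
  σ false (⁺1 , true ) = ⁻1 , false
  σ false (⁺2 , false) = ⁻2 , false
  σ false (⁺2 , true ) = ⁻1 , true
  σ false (⁺3 , false) = ⁺1 , false
  σ false (⁺3 , true ) = ⁻3 , false
  σ false (⁻1 , false) = ⁺1 , true
  σ false (⁻1 , true ) = ⁺2 , true
  σ false (⁻2 , false) = ⁺2 , false
  σ false (⁻2 , true ) = ⁻3 , true
  σ false (⁻3 , false) = ⁺3 , true
  σ false (⁻3 , true ) = ⁻2 , true
  σ true  (⁺1 , false) = ⁻1 , false
  σ true  (⁺1 , true ) = ⁺3 , false
  σ true  (⁺2 , false) = ⁻1 , true
  σ true  (⁺2 , true ) = ⁻2 , false
  σ true  (⁺3 , false) = ⁺1 , true
  σ true  (⁺3 , true ) = ⁻3 , true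
  σ true  (⁻1 , false) = ⁺1 , false
  σ true  (⁻1 , true ) = ⁺2 , false
  σ true  (⁻2 , false) = ⁺2 , true
  σ true  (⁻2 , true ) = ⁻3 , false
  σ true  (⁻3 , false) = ⁻2 , true
  σ true  (⁻3 , true ) = ⁺3 , true

  σ-invol : ∀ e p → σ e (σ e p) ≡ p
  σ-invol = from-yes (∀Bool? λ e → ∀Slot? λ p → σ e (σ e p) ≟ˢ p)

  σ-label : ∀ e p → proj₁ (σ e p) ≢ proj₁ p
  σ-label = from-yes (∀Bool? λ e → ∀Slot? λ p → ¬? (proj₁ (σ e p) ≟ᴸ proj₁ p))

  module At (e : Bool) = Links (σ e) (σ-invol e)

  reach : ∀ e l → At._~_ e l ⁺1
  reach false = λ where
      ⁺1 → ~-refl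
      ⁺2 → ⁺2~
      ⁺3 → link {d = false} refl
      ⁻1 → link {d = false} refl
      ⁻2 → link {d = false} refl ⟫ ⁺2~
      ⁻3 → link {d = false} refl ⟫ link {d = false} refl
    where
    open At false
    ⁺2~ : ⁺2 ~ ⁺1
    ⁺2~ = link {d = true} refl ⟫ link {d = false} refl
  reach true = λ where
      ⁺1 → ~-refl
      ⁺2 → ⁺2~
      ⁺3 → link {d = false} refl
      ⁻1 → link {d = false} refl
      ⁻2 → link {d = false} refl ⟫ ⁺2~
      ⁻3 → link {d = true} refl ⟫ link {d = false} refl
    where
    open At true
    ⁺2~ : ⁺2 ~ ⁺1
    ⁺2~ = link {d = false} refl ⟫ link {d = false} refl

  closes : ∀ e p → σ (not e) (σ e (σ (not e) (σ e p))) ≡ p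
  closes = from-yes (∀Bool? λ e → ∀Slot? λ p → σ (not e) (σ e (σ (not e) (σ e p))) ≟ˢ p)

  opaque
    unfolding _⊕_ val
    -- Evaluated, since 2 + 2 = -2 - 1 and 3 - 2 = -3 - 3 hold only modulo 7.
    flat : ∀ e p → holonomy σ e p ≡ zero
    flat = from-yes (∀Bool? λ e → ∀Slot? λ p → holonomy σ e p ≟ zero)

  scheme : Scheme
  scheme = record
    { σ       = σ
    ; σ-invol = σ-invol
    ; σ-label = σ-label
    ; origin  = ⁺1 , false
    ; reach   = λ e (l , d) → reach e l d false
    ; closes  = closes
    ; flat    = flat
    }

  result : Σ (Embedding 7) (λ E → Quadrangular E × Nonorientable E)
  result = embedding M , quadrangular M , nonorientable M
    -- The face (1 , 3 , 1 , -1) meets both sides of label 1: two of its edges lead from one at w_u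
    -- to the other at w_{u+3-1}.
    (twisted 3 M (λ u → false , u , ⁺1 , false) (g₂ ∷ g₀ ∷ g₁ ∷ g₀ ∷ g₁ ∷ [])
      (weight false ⁺3 ⊕ weight true ⁺1) (λ { false → refl ; true → refl })
      (λ u → cong (λ v → false , v , ⁺1 , false) (⊕-assoc u _ _)))
    where
    M = schemeModel scheme

-- Even n: n = N + 1, with two vertices at infinity.

module Even (M : ℕ) where

  open Cyclic (suc M)

  -- Directed edges out of a vertex: inner u l joins finite vertices, spoke u goes from u to infinity and
  -- hub u from infinity to u.
  data Dart : Set where
    inner     : Fin N → Label → Dart
    spoke hub : Fin N → Dart

  top : Fin (suc M)
  top = fromℕ M

  -- The last labels ±m spend their sides `true` in the faces at b_∞, meeting the spoke at white
  -- vertices and each other at black ones. For the sides `false` of ±1, in the faces at w_∞, the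
  -- colours are exchanged.
  onward : Bool → Fin N → Bool → {k : Fin (suc M)} → View k → Dart × Bool
  onward e     u s (‵inj₁ {i = i} _) = inner u (s xor e , suc i) , false
  onward false u s ‵fromℕ = spoke u , s
  onward true  u s ‵fromℕ = inner u (not s , top) , true

  twice : Fin N → Label → Fin N
  twice u l = (u ⊕ val l) ⊕ val l

  end : Bool → Fin (suc M)
  end e = if e then top else zero

  -- The side of an edge to infinity is the sign of the label beside it at its finite end: ±m at
  -- white, ±1 at black vertices. The next edge at infinity ends two equal steps away, across the
  -- face, and has that face on its other side; as labels act with opposite signs at the two
  -- colours, `e` enters the sign.
  σ : Bool → Dart × Bool → Dart × Bool
  σ e     (inner u (s , k)     , true)  = onward e u s (view k)
  σ e     (inner u (s , suc k) , false) = inner u (s xor e , inject₁ k) , true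
  σ false (inner u (s , zero)  , false) = inner u (not s , zero) , false
  σ true  (inner u (s , zero)  , false) = spoke u , s
  σ false (spoke u , s) = inner u (s , top) , true
  σ true  (spoke u , s) = inner u (s , zero) , false
  σ e     (hub u , s)   = hub (twice u (not (s xor e) , end e)) , not s

  σ-top : ∀ e u s → σ e (inner u (s , top) , true) ≡ onward e u s ‵fromℕ
  σ-top e u s = cong (onward e u s) (view-fromℕ M)

  σ-chain : ∀ e u s (k : Fin M) → σ e (inner u (s , inject₁ k) , true) ≡ (inner u (s xor e , suc k) , false)
  σ-chain e u s k = cong (onward e u s) (view-inject₁ k)

  twice-back : ∀ u l → twice (twice u l) (opp l) ≡ u
  twice-back u l = sum₄ u (crossing (val-opp l) (val-opp l))

  xor-xor : ∀ s e → (s xor e) xor e ≡ s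
  xor-xor false false = refl
  xor-xor false true  = refl
  xor-xor true  false = refl
  xor-xor true  true  = refl

  σ-invol : ∀ e q → σ e (σ e q) ≡ q
  σ-invol e (inner u (s , k) , true) with view k
  σ-invol false (inner u (s , _) , true) | ‵fromℕ = refl
  σ-invol true  (inner u (s , _) , true) | ‵fromℕ =
    trans (σ-top true u (not s)) (cong (λ s → inner u (s , top) , true) (not-involutive s))
  σ-invol e     (inner u (s , _) , true) | ‵inject₁ i = cong (λ s → inner u (s , inject₁ i) , true) (xor-xor s e)
  σ-invol e     (inner u (s , suc k) , false) =
    trans (σ-chain e u (s xor e) k) (cong (λ s → inner u (s , suc k) , false) (xor-xor s e))
  σ-invol false (inner u (s , zero)  , false) = cong (λ s → inner u (s , zero) , false) (not-involutive s)
  σ-invol true  (inner u (s , zero)  , false) = refl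
  σ-invol false (spoke u , s) = σ-top false u s
  σ-invol true  (spoke u , s) = refl
  σ-invol false (hub u , false) = cong (λ v → hub v , false) (twice-back u (true , end false))
  σ-invol false (hub u , true)  = cong (λ v → hub v , true) (twice-back u (false , end false))
  σ-invol true  (hub u , false) = cong (λ v → hub v , false) (twice-back u (false , end true))
  σ-invol true  (hub u , true)  = cong (λ v → hub v , true) (twice-back u (true , end true))

  X : Set
  X = Bool × Dart × Bool

  t₀ t₁ t₂ : X → X
  t₀ (e , inner u l , d) = not e , inner (move e l u) l , d
  t₀ (e , spoke u   , d) = not e , hub u , d
  t₀ (e , hub u     , d) = not e , spoke u , d
  t₁ (e , q) = e , σ e q
  t₂ (e , q , d) = e , q , not d

  -- Infinity has index `zero`, so that w_∞ b_∞ belongs to the deleted diagonal.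
  at : Dart → Fin (suc N)
  at (inner u _) = suc u
  at (spoke u)   = suc u
  at (hub u)     = zero

  nbr : Bool → Dart → Fin (suc N)
  nbr e (inner u l) = suc (move e l u)
  nbr e (spoke u)   = zero
  nbr e (hub u)     = suc u

  at-σ : ∀ e q → at (proj₁ (σ e q)) ≡ at (proj₁ q)
  at-σ e     (inner u (s , k) , true) with view k
  at-σ false (inner u (s , _) , true) | ‵fromℕ = refl
  at-σ true  (inner u (s , _) , true) | ‵fromℕ = refl
  at-σ e     (inner u (s , _) , true) | ‵inject₁ i = refl
  at-σ e     (inner u (s , suc k) , false) = refl
  at-σ false (inner u (s , zero)  , false) = refl
  at-σ true  (inner u (s , zero)  , false) = refl
  at-σ false (spoke u , s) = refl
  at-σ true  (spoke u , s) = refl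
  at-σ e     (hub u , s) = refl

  apart : ∀ e u {l l′} → l ≢ l′ → nbr e (inner u l) ≢ nbr e (inner u l′)
  apart e u l≢l′ eq = l≢l′ (move-injective e u (suc-injective eq))

  nbr-σ : ∀ e q → nbr e (proj₁ (σ e q)) ≢ nbr e (proj₁ q)
  nbr-σ e     (inner u (s , k) , true) with view k
  nbr-σ false (inner u (s , _) , true) | ‵fromℕ = λ ()
  nbr-σ true  (inner u (s , _) , true) | ‵fromℕ = apart true u {not s , top} {s , top} (not≢ ∘ cong proj₁)
  nbr-σ e     (inner u (s , _) , true) | ‵inject₁ i = apart e u {s xor e , suc i} {s , inject₁ i} (inject₁≢suc ∘ sym ∘ cong proj₂)
  nbr-σ e     (inner u (s , suc k) , false) = apart e u {s xor e , inject₁ k} {s , suc k} (inject₁≢suc ∘ cong proj₂)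
  nbr-σ false (inner u (s , zero)  , false) = apart false u {not s , zero} {s , zero} (not≢ ∘ cong proj₁)
  nbr-σ true  (inner u (s , zero)  , false) = λ ()
  nbr-σ false (spoke u , s) = λ ()
  nbr-σ true  (spoke u , s) = λ ()
  nbr-σ e     (hub u , s) = ⊕-⊕-val≢ u (not (s xor e) , end e) ∘ suc-injective

  nbr-t₀ : ∀ e q → at (proj₁ (proj₂ (t₀ (e , q)))) ≡ nbr e (proj₁ q)
  nbr-t₀ e (inner u l , d) = refl
  nbr-t₀ e (spoke u , d) = refl
  nbr-t₀ e (hub u , d) = refl

  R : X → X
  R = t₀ ∘ t₁

  iter₄ : ∀ {x a b c d} → R x ≡ a → R a ≡ b → R b ≡ c → R c ≡ d → d ≡ x → iter R 4 x ≡ x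
  iter₄ refl refl refl refl eq = eq

  -- The walk alternates between `there` and `back`, and each label recurs with the opposite sign.
  face-± : ∀ e s u {k d k′ d′} →
           (∀ e s u → σ e (inner u (s , k) , d) ≡ (inner u (s xor e , k′) , d′)) →
           (∀ e s u → σ e (inner u (s , k′) , d′) ≡ (inner u (s xor e , k) , d)) →
           iter R 4 (e , inner u (s , k) , d) ≡ (e , inner u (s , k) , d)
  face-± e s u {k} {d} {k′} {d′} there back = go e s
    where
    to : ∀ e s u → R (e , inner u (s , k) , d) ≡ (not e , inner (move e (s xor e , k′) u) (s xor e , k′) , d′)
    to e s u = cong (λ q → t₀ (e , q)) (there e s u)
    fro : ∀ e s u → R (e , inner u (s , k′) , d′) ≡ (not e , inner (move e (s xor e , k) u) (s xor e , k) , d)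
    fro e s u = cong (λ q → t₀ (e , q)) (back e s u)
    home : ∀ e s s′ → _≡_ {A = X}
      (e , inner ((((u ⊕ val (s , k′)) ⊕ val (s′ , k)) ⊕ val (not s , k′)) ⊕ val (not s′ , k)) (s , k) , d)
      (e , inner u (s , k) , d)
    home e s s′ = cong (λ v → e , inner v (s , k) , d) (sum₄ u (crossing (val-opp (s , k′)) (val-opp (s′ , k))))
    go : ∀ e s → iter R 4 (e , inner u (s , k) , d) ≡ (e , inner u (s , k) , d)
    go false false = iter₄ (to false false u) (fro true false _) (to false true _) (fro true true _) (home false false false)
    go false true  = iter₄ (to false true u) (fro true true _) (to false false _) (fro true false _) (home false true true)
    go true  false = iter₄ (to true false u) (fro false true _) (to true true _) (fro false false _) (home true false true)
    go true  true  = iter₄ (to true true u) (fro false false _) (to true false _) (fro false true _) (home true true false)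

  R-top : ∀ e u s → R (e , inner u (s , top) , true) ≡ t₀ (e , onward e u s ‵fromℕ)
  R-top e u s = cong (λ q → t₀ (e , q)) (σ-top e u s)

  face-right : ∀ e u s {k} → View k → iter R 4 (e , inner u (s , k) , true) ≡ (e , inner u (s , k) , true)
  face-right e u s (‵inject₁ i) = face-± e s u (λ e s u → σ-chain e u s i) (λ _ _ _ → refl)
  -- Up to sign a face at b_∞ has displacements m, m, -m, -m in cyclic order, two of them in the
  -- single turn at the hub. The starting corner decides between `crossing` and `adjacent`.
  face-right false u false ‵fromℕ = iter₄ (R-top false _ _) refl refl (R-top true _ _)
    (cong (λ v → false , inner v (false , top) , true) (sum₄ u (crossing (val-opp (false , top)) (val-opp (false , top)))))
  face-right false u true  ‵fromℕ = iter₄ (R-top false _ _) refl refl (R-top true _ _)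
    (cong (λ v → false , inner v (true , top) , true) (sum₄ u (crossing (val-opp (true , top)) (val-opp (true , top)))))
  face-right true  u false ‵fromℕ = iter₄ (R-top true _ _) (R-top false _ _) refl refl
    (cong (λ v → true , inner v (false , top) , true) (sum₄ u (adjacent (val-opp (false , top)) (val-opp (true , top)))))
  face-right true  u true  ‵fromℕ = iter₄ (R-top true _ _) (R-top false _ _) refl refl
    (cong (λ v → true , inner v (true , top) , true) (sum₄ u (adjacent (val-opp (true , top)) (val-opp (false , top)))))

  face : ∀ x → iter R 4 x ≡ x
  face (e , inner u (s , suc k) , false) = face-± e s u (λ _ _ _ → refl) (λ e s u → σ-chain e u s k)
  face (e , inner u (s , k) , true) = face-right e u s (view k)
  face (true  , hub u , false) = iter₄ refl refl (R-top true _ _) (R-top false _ _)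
    (cong (λ v → true , hub v , false) (sum₄ u (crossing (val-opp (false , top)) (val-opp (false , top)))))
  face (true  , hub u , true ) = iter₄ refl refl (R-top true _ _) (R-top false _ _)
    (cong (λ v → true , hub v , true) (sum₄ u (crossing (val-opp (true , top)) (val-opp (true , top)))))
  face (false , spoke u , false) = iter₄ refl (R-top true _ _) (R-top false _ _) refl
    (cong (λ v → false , spoke v , false) (sum₄ u (crossing (val-opp (false , top)) (val-opp (false , top)))))
  face (false , spoke u , true ) = iter₄ refl (R-top true _ _) (R-top false _ _) refl
    (cong (λ v → false , spoke v , true) (sum₄ u (crossing (val-opp (true , top)) (val-opp (true , top)))))
  face (false , inner u (false , zero) , false) =
    cong (λ v → false , inner v (false , zero) , false) (sum₄ u (adjacent (val-opp (true , zero)) (val-opp (false , zero))))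
  face (false , inner u (true  , zero) , false) =
    cong (λ v → false , inner v (true , zero) , false) (sum₄ u (adjacent (val-opp (false , zero)) (val-opp (true , zero))))
  face (true  , inner u (false , zero) , false) =
    cong (λ v → true , inner v (false , zero) , false) (sum₄ u (crossing (val-opp (true , zero)) (val-opp (true , zero))))
  face (true  , inner u (true  , zero) , false) =
    cong (λ v → true , inner v (true , zero) , false) (sum₄ u (crossing (val-opp (false , zero)) (val-opp (false , zero))))
  face (false , hub u , false) =
    cong (λ v → false , hub v , false) (sum₄ u (crossing (val-opp (true , zero)) (val-opp (true , zero))))
  face (false , hub u , true ) =
    cong (λ v → false , hub v , true) (sum₄ u (crossing (val-opp (false , zero)) (val-opp (false , zero))))
  face (true  , spoke u , false) =
    cong (λ v → true , spoke v , false) (sum₄ u (crossing (val-opp (true , zero)) (val-opp (true , zero))))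
  face (true  , spoke u , true ) =
    cong (λ v → true , spoke v , true) (sum₄ u (crossing (val-opp (false , zero)) (val-opp (false , zero))))

  module At (e : Bool) = Links (σ e) (σ-invol e)
  open At

  -- The chain descends to ±1, which are joined directly at white vertices and through the spoke at
  -- black ones.
  reach-inner : ∀ e u s k → _~_ e (inner u (s , k)) (inner u (false , zero))
  reach-inner e u s k = <-weakInduction (λ k → ∀ s → _~_ e (inner u (s , k)) (inner u (false , zero)))
    (from-zero e) (λ k ih s → _⟫_ e (link e {d = false} refl) (ih (s xor e))) k s
    where
    from-zero : ∀ e s → _~_ e (inner u (s , zero)) (inner u (false , zero))
    from-zero e     false = ~-refl e
    from-zero false true  = link false {d = false} refl
    from-zero true  true  = _⟫_ true (link true {d = false} refl) (link true {d = false} refl)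

  reach-spoke : ∀ e u → _~_ e (spoke u) (inner u (false , zero))
  reach-spoke false u = _⟫_ false (link false {d = false} refl) (reach-inner false u false top)
  reach-spoke true  u = link true {d = false} refl

  -- The rotation at infinity is a translation by a generator of ℤ_N, hence a single cycle.
  reach-hub : ∀ e u → _~_ e (hub u) (hub zero)
  reach-hub e u = ~-sym e (subst (λ v → _~_ e (hub zero) (hub v))
    (trans (⊕-comm zero _) (trans (⊕-identityʳ _) (generates e u))) (walk e (cofactor e u) zero))
    where
    step : Bool → Fin N
    step e = val (e , end e) ⊕ val (e , end e)
    walk : ∀ e c u → _~_ e (hub u) (hub (u ⊕ times c (step e)))
    walk e zero u = subst (λ v → _~_ e (hub u) (hub v)) (sym (⊕-identityʳ u)) (~-refl e)
    walk e (suc c) u = _⟫_ e (one e) (subst (λ v → _~_ e (hub (u ⊕ step e)) (hub v)) (⊕-assoc u _ _) (walk e c (u ⊕ step e)))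
      where
      one : ∀ e → _~_ e (hub u) (hub (u ⊕ step e))
      one false = subst (λ v → _~_ false (hub u) (hub v)) (⊕-assoc u _ _) (link false {d = true} refl)
      one true  = subst (λ v → _~_ true (hub u) (hub v)) (⊕-assoc u _ _) (link true {d = true} refl)
    -- The steps at w_∞ and b_∞ are 2 and -2m = 1; the inverse of 2 is m + 1.
    cofactor : Bool → Fin N → ℕ
    cofactor false u = toℕ u * suc (suc M)
    cofactor true  u = toℕ u * 1
    -- With m = M + 1, the residue of -m is m + 1.
    toℕ-val-top : toℕ (val (true , top)) ≡ suc (suc M)
    toℕ-val-top = begin
      toℕ (val (true , top))                    ≡⟨ toℕ-val⁻ top ⟩
      suc (suc M + (suc M ∸ suc (toℕ top)))     ≡⟨ cong (λ x → suc (suc M + (M ∸ x))) (toℕ-fromℕ M) ⟩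
      suc (suc M + (M ∸ M))                     ≡⟨ cong (λ x → suc (suc M + x)) (ℕ.n∸n≡0 M) ⟩
      suc (suc M + 0)                           ≡⟨ ℕ.+-identityʳ _ ⟩
      suc (suc M)                               ∎
      where open ≡-Reasoning
    step-mod : ∀ l {x} → toℕ (val l) ≡ x → val l ⊕ val l ≡ (x + x) mod N
    step-mod l eq = trans (⊕-def _ _) (cong (λ x → (x + x) mod N) eq)
    generates : ∀ e u → times (cofactor e u) (step e) ≡ u
    generates false = times-generator 2 (suc (suc M)) (step-mod (false , zero) (toℕ-val⁺ zero)) (product M)
      where
      product : ∀ M → suc (suc M) * 2 ≡ 1 + suc (suc M + suc M)
      product = solve-∀
    -- As a natural number the step is 2 (m + 1) = 1 + N, so the cofactor is 1.
    generates true  = times-generator (suc (suc M) + suc (suc M)) 1 (step-mod (true , top) toℕ-val-top) (product M)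
      where
      product : ∀ M → 1 * (suc (suc M) + suc (suc M)) ≡ 1 + suc (suc M + suc M)
      product = solve-∀

  origin : Fin (suc N) → Dart
  origin zero    = hub zero
  origin (suc u) = inner u (false , zero)

  reach : ∀ e q → _~_ e q (origin (at q))
  reach e (inner u (s , k)) = reach-inner e u s k
  reach e (spoke u)         = reach-spoke e u
  reach e (hub u)           = reach-hub e u

  lab : ∀ {i j} → False (suc i ≟ suc j) → Σ Label λ l → move false l i ≡ j
  lab p = between (toWitnessFalse p ∘ cong suc)

  to : Flag (suc N) → X
  to (flag zero    (suc j) p false d) = false , hub j , d
  to (flag zero    (suc j) p true  d) = true , spoke j , d
  to (flag (suc i) zero    p false d) = false , spoke i , d
  to (flag (suc i) zero    p true  d) = true , hub i , d
  to (flag (suc i) (suc j) p false d) = false , inner i (proj₁ (lab p)) , d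
  to (flag (suc i) (suc j) p true  d) = true , inner j (proj₁ (lab p)) , d

  off : ∀ e u l → False (suc (move e l u) ≟ suc u)
  off e u l = fromWitnessFalse (move≢ e l u ∘ suc-injective)

  off′ : ∀ e u l → False (suc u ≟ suc (move e l u))
  off′ e u l = fromWitnessFalse (move≢ e l u ∘ sym ∘ suc-injective)

  from : X → Flag (suc N)
  from (false , inner u l , d) = flag (suc u) (suc (move false l u)) (off′ false u l) false d
  from (true  , inner u l , d) = flag (suc (move true l u)) (suc u) (off true u l) true d
  from (false , spoke u   , d) = flag (suc u) zero _ false d
  from (true  , spoke u   , d) = flag zero (suc u) _ true d
  from (false , hub u     , d) = flag zero (suc u) _ false d
  from (true  , hub u     , d) = flag (suc u) zero _ true d

  model : Model (suc N)
  model = record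
    { X = X ; t₀ = t₀ ; t₁ = t₁ ; t₂ = t₂ ; vx = λ (e , q , _) → e , at q
    ; to = to ; from = from ; to-from = to-from ; from-to = from-to
    ; from-t₀ = from-t₀ ; from-t₂ = from-t₂ ; from-vx = from-vx
    ; t₁-invol = λ (e , q) → cong (e ,_) (σ-invol e q)
    ; t₁-vx = λ (e , q) → cong (e ,_) (at-σ e q)
    ; t₁-nbr = λ (e , q) eq → nbr-σ e q (trans (sym (nbr-t₀ e (σ e q))) (trans (cong proj₂ eq) (nbr-t₀ e q)))
    ; base = λ (e , v) → e , origin v , false
    ; reach = λ (e , q , d) → gmap (e ,_) step (reach e q d false)
    ; face = face
    }
    where
    to-from : ∀ x → to (from x) ≡ x
    to-from (false , inner u l , d) = cong (λ l → false , inner u l , d) (move-injective false u (proj₂ (lab (off′ false u l))))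
    to-from (true  , inner u l , d) = cong (λ l → true , inner u l , d)
      (move-injective false (move true l u) (trans (proj₂ (lab (off true u l))) (sym (move-back true l u))))
    to-from (false , spoke u , d) = refl
    to-from (true  , spoke u , d) = refl
    to-from (false , hub u , d) = refl
    to-from (true  , hub u , d) = refl
    from-to : ∀ f → from (to f) ≡ f
    from-to (flag zero    (suc j) p false d) = refl
    from-to (flag zero    (suc j) p true  d) = refl
    from-to (flag (suc i) zero    p false d) = refl
    from-to (flag (suc i) zero    p true  d) = refl
    from-to (flag (suc i) (suc j) p false d) = flag-cong refl (cong suc (proj₂ (lab p)))
    from-to (flag (suc i) (suc j) p true  d) = flag-cong (cong suc
      (trans (cong (move true (proj₁ (lab p))) (sym (proj₂ (lab p)))) (move-back false (proj₁ (lab p)) i))) refl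
    from-t₀ : ∀ x → τ₀ (from x) ≡ from (t₀ x)
    from-t₀ (false , inner u l , d) = flag-cong (cong suc (sym (move-back false l u))) refl
    from-t₀ (true  , inner u l , d) = flag-cong refl (cong suc (sym (move-back true l u)))
    from-t₀ (false , spoke u , d) = refl
    from-t₀ (true  , spoke u , d) = refl
    from-t₀ (false , hub u , d) = refl
    from-t₀ (true  , hub u , d) = refl
    from-t₂ : ∀ x → τ₂ (from x) ≡ from (t₂ x)
    from-t₂ (false , inner u l , d) = refl
    from-t₂ (true  , inner u l , d) = refl
    from-t₂ (false , spoke u , d) = refl
    from-t₂ (true  , spoke u , d) = refl
    from-t₂ (false , hub u , d) = refl
    from-t₂ (true  , hub u , d) = refl
    from-vx : ∀ x → vertexOf (from x) ≡ (proj₁ x , at (proj₁ (proj₂ x)))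
    from-vx (false , inner u l , d) = refl
    from-vx (true  , inner u l , d) = refl
    from-vx (false , spoke u , d) = refl
    from-vx (true  , spoke u , d) = refl
    from-vx (false , hub u , d) = refl
    from-vx (true  , hub u , d) = refl
    step : ∀ {e p q} → Step (σ e) (λ (l , d) → l , not d) p q → Step t₁ t₂ (e , p) (e , q)
    step (inj₁ refl) = inj₁ refl
    step (inj₂ refl) = inj₂ refl

module EvenEmbedding (K : ℕ) where
  open Cyclic (suc (suc K))
  open Even (suc K)

  result : Σ (Embedding (suc N)) (λ E → Quadrangular E × Nonorientable E)
  result = embedding model , quadrangular model , nonorientable model
    -- Two edges of the chain face (1 , 2 , -1 , -2) lead from label 1 at w_u to label -1 at
    -- w_{u+2+1}; the corner (1 , -1) of a face at w_∞ leads back to label 1.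
    (twisted (suc (suc K)) model (λ u → false , inner u (false , zero) , false) (g₁ ∷ g₂ ∷ g₀ ∷ g₁ ∷ g₀ ∷ g₁ ∷ g₂ ∷ [])
      (weight false (false , suc zero) ⊕ weight true (true , zero)) (λ { false → refl ; true → refl })
      (λ u → cong (λ v → false , inner v (false , zero) , false) (⊕-assoc u _ _)))

-- All n at least 6, by parity.

halves : ∀ k → Σ ℕ (λ h → k ≡ h + h ⊎ k ≡ suc (h + h))
halves zero = 0 , inj₁ refl
halves (suc k) with halves k
... | h , inj₁ eq = h , inj₂ (cong suc eq)
... | h , inj₂ eq = suc h , inj₁ (cong suc (trans eq (sym (ℕ.+-suc h h))))

theorem2 : (n : ℕ) → 6 ≤ n → Σ (Embedding n) (λ E → Quadrangular E × Nonorientable E)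
theorem2 n 6≤n = subst P (ℕ.m+[n∸m]≡n 6≤n) (from-half (n ∸ 6) (halves (n ∸ 6)))
  where
  P : ℕ → Set
  P n = Σ (Embedding n) (λ E → Quadrangular E × Nonorientable E)
  even-size : ∀ h → suc (suc (suc (suc h) + suc (suc h))) ≡ 6 + (h + h)
  even-size = solve-∀
  odd-size : ∀ h → suc ((4 + h) + (4 + h)) ≡ 7 + (suc h + suc h)
  odd-size = solve-∀
  from-half : ∀ k → Σ ℕ (λ h → k ≡ h + h ⊎ k ≡ suc (h + h)) → P (6 + k)
  -- 6 + 2h is N + 1 for m = h + 2, and 9 + 2h is N for m = h + 4; between them only 7 is left.
  from-half _ (h     , inj₁ refl) = subst P (even-size h) (EvenEmbedding.result h)
  from-half _ (zero  , inj₂ refl) = OddSeven.result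
  from-half _ (suc h , inj₂ refl) = subst P (odd-size h) (OddLarge.result h)
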